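{- For all $n\ge1$ we have $|F_n(321,2143)|=2^{n-1}$.
   Context: A Fishburn permutation is a permutation $\pi$ (in one-line notation) with no subsequence $\pi_j,\pi_{j+1},\pi_k$ such that $j+1<k$, $\pi_j=\pi_k+1$, and $\pi_{j+1}>\pi_j$. $F_n(321,2143)$ is the set of Fishburn permutations of length $n$ avoiding the classical patterns $321$ and $2143$ (i.e. having no subsequence with the same relative order as either). -}

module Defs where

open import Data.Fin.Base using (Fin; toℕ) renaming (_<_ to _<ᶠ_)
open import Data.Fin.Permutation using (Permutation′; _⟨$⟩ʳ_)
open import Data.List.Base using (List)
open import Data.List.Relation.Unary.All using (All)
open import Data.Nat.Base using (ℕ; suc; _<_)
open import Data.Product.Base using (Σ; ∃; ∃-syntax; _,_; _×_; proj₁)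
open import Data.Vec.Base using (Vec; []; _∷_; lookup)
open import Function.Bundles using (Bijection; _⇔_)
open import Level using (0ℓ; _⊔_)
open import Relation.Binary.Bundles using (Setoid)
open import Relation.Binary.Core using (_Preserves_⟶_)
import Relation.Binary.Construct.On as On
open import Relation.Binary.PropositionalEquality using (_≡_; setoid; _→-setoid_)
open import Relation.Nullary.Negation using (¬_)

-- Positions and values run over 0,…,n-1 instead of 1,…,n; every notion
-- below is invariant under this shift.

Fishburn : ∀ {n} → Permutation′ n → Set
Fishburn {n} π = ¬ (∃[ j ] ∃[ j⁺ ] ∃[ k ]
    toℕ j⁺ ≡ suc (toℕ j)
  × j⁺ <ᶠ k
  × toℕ (π ⟨$⟩ʳ j) ≡ suc (toℕ (π ⟨$⟩ʳ k))
  × (π ⟨$⟩ʳ j) <ᶠ (π ⟨$⟩ʳ j⁺))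

-- A pattern is given by its one-line notation, e.g. 2 ∷ 1 ∷ 4 ∷ 3 ∷ [].

Pattern : Set
Pattern = ∃ (Vec ℕ)

Contains : ∀ {n k} → Permutation′ n → Vec ℕ k → Set
Contains {n} {k} π σ = Σ (Fin k → Fin n) λ p →
    p Preserves _<ᶠ_ ⟶ _<ᶠ_
  × (∀ a b → lookup σ a < lookup σ b ⇔ (π ⟨$⟩ʳ p a) <ᶠ (π ⟨$⟩ʳ p b))

Avoids : ∀ {n k} → Permutation′ n → Vec ℕ k → Set
Avoids π σ = ¬ Contains π σ

-- Permutations are compared by their one-line notation only: the inverse
-- and the proofs stored in the carrier are irrelevant to equality.

F : ℕ → List Pattern → Setoid 0ℓ 0ℓ
F n σs = On.setoid {B = Carrier} (Fin n →-setoid Fin n) (λ π → proj₁ π ⟨$⟩ʳ_)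
  where
  Carrier : Set
  Carrier = Σ (Permutation′ n) λ π → Fishburn π × All (λ (_ , σ) → Avoids π σ) σs

HasCardinality : ∀ {c ℓ} → Setoid c ℓ → ℕ → Set (c ⊔ ℓ)
HasCardinality S m = Bijection S (setoid (Fin m))

p321 p2143 : Pattern
p321  = _ , 3 ∷ 2 ∷ 1 ∷ []
p2143 = _ , 2 ∷ 1 ∷ 4 ∷ 3 ∷ []

{-# OPTIONS --safe #-}
module Submission where

-- A permutation in the class is determined by its set D of dominated positions
-- (those that are not left-to-right maxima), and every set avoiding the first
-- position occurs. For i < j, the pair (i, j) is an inversion exactly when i ∉ D,
-- j ∈ D and some k ≤ i + 1 lies in D: the last condition is necessary by the
-- Fishburn property and sufficient by avoidance of 2143. So D determines the
-- inversions, hence the permutation. Conversely, given D, call i high if i ∉ D and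
-- some k ≤ i + 1 lies in D; the permutation giving the low positions the smallest
-- values and the high positions the largest, increasing on each, lies in the class
-- and has D as its set of dominated positions.

open import Defs
open import Data.Bool.Base using (Bool; true; T)
open import Data.Bool.Properties using (T?)
open import Data.Empty using (⊥; ⊥-elim)
open import Data.Fin.Base using (Fin; zero; suc; toℕ; fromℕ<; combine; punchOut; funToFin; finToFun; _<_)
  renaming (_≤_ to _≤ᶠ_)
open import Data.Fin.Patterns using (0F; 1F; 2F; 3F)
open import Data.Fin.Permutation using (Permutation′; _⟨$⟩ʳ_; _⟨$⟩ˡ_; _≈_; permutation; inverseˡ; inverseʳ)
open import Data.Fin.Properties
  using (_≟_; _<?_; any?; all?; <-cmp; ≤-antisym; toℕ<n; toℕ-injective; toℕ-fromℕ<;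
         injective⇒≤; injective⇒existsPivot; punchOut-injective; 2↔Bool; finToFun-funToFin; funToFin-finToFin)
open import Data.Fin.Subset using (Subset; _∈_; ∣_∣)
open import Data.Fin.Subset.Properties using (p⊂q⇒∣p∣<∣q∣; ∈⊤; ∣⊤∣≡n)
open import Data.List.Base using ([]; _∷_)
open import Data.List.Relation.Unary.All using ([]; _∷_)
open import Data.Nat.Base using (ℕ; zero; suc; _+_; _≤_; z≤n; s≤s; s≤s⁻¹; z<s; s<s; _<ᵇ_; _∸_; _^_)
  renaming (_<_ to _<ⁿ_)
import Data.Nat.Properties as ℕ
open import Data.Product.Base using (∃-syntax; ∃₂; _,_; _×_; proj₁; proj₂)
open import Data.Sum.Base using (inj₁; inj₂)
open import Data.Vec.Base using (Vec; []; _∷_; lookup; tabulate)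
open import Data.Vec.Properties using (lookup∘tabulate; lookup⇒[]=; []=⇒lookup)
open import Data.Vec.Relation.Unary.Linked using (Linked; [-]; _∷_)
open import Data.Vec.Relation.Unary.Linked.Properties using (lookup⁺)
open import Function.Base using (_∘_; id)
open import Function.Bundles using (Inverse; Equivalence; _⇔_; mk⇔)
open import Function.Definitions using (Injective; Surjective)
open import Level using (0ℓ)
open import Relation.Binary.Bundles using (Setoid)
open import Relation.Binary.Core using (_Preserves_⟶_)
open import Relation.Binary.Definitions using (tri<; tri≈; tri>)
open import Relation.Binary.PropositionalEquality
open import Relation.Nullary using (¬_; Dec; yes; no; does; contradiction)
open import Relation.Nullary.Decidable using (_×-dec_; _→-dec_; ¬?; True; toWitness; isYes; isYes≗does; does-⇔; decidable-stable; dec-true)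
open import Relation.Unary using (Pred; Decidable)

private variable
  k m n : ℕ

-- Discrete intermediate values and monotone maps of finite ordinals.

crossing : {P : Pred (Fin n) 0ℓ} → Decidable P → ∀ {x y} → x ≤ᶠ y → P x → ¬ P y →
  ∃₂ λ v v⁺ → v⁺ ≤ᶠ y × toℕ v⁺ ≡ suc (toℕ v) × P v × ¬ P v⁺
crossing P? {zero} {zero} _ Px ¬Py = contradiction Px ¬Py
crossing {n = suc (suc _)} P? {zero} {suc y} _ Px ¬Py with P? (suc zero)
... | no ¬P1 = zero , suc zero , s≤s z≤n , refl , Px , ¬P1
... | yes P1 with v , v⁺ , le , eq , Pv , ¬Pv⁺ ← crossing (P? ∘ suc) {zero} {y} z≤n P1 ¬Py =
  suc v , suc v⁺ , s≤s le , cong suc eq , Pv , ¬Pv⁺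
crossing P? {suc x} {suc y} (s≤s x≤y) Px ¬Py
  with v , v⁺ , le , eq , Pv , ¬Pv⁺ ← crossing (P? ∘ suc) x≤y Px ¬Py =
  suc v , suc v⁺ , s≤s le , cong suc eq , Pv , ¬Pv⁺

monotone⇒injective : {f : Fin n → Fin k} → f Preserves _<_ ⟶ _<_ → Injective _≡_ _≡_ f
monotone⇒injective mono {i} {j} eq with <-cmp i j
... | tri< i<j _ _ = contradiction (mono i<j) (ℕ.<-irrefl (cong toℕ eq))
... | tri≈ _ i≡j _ = i≡j
... | tri> _ _ j<i = contradiction (mono j<i) (ℕ.<-irrefl (cong toℕ (sym eq)))

-- By pigeonhole some `j ≤ i` has `i ≤ f j`, and monotonicity gives `f j ≤ f i`.
monotone⇒inflationary : {f : Fin n → Fin n} → f Preserves _<_ ⟶ _<_ → ∀ i → i ≤ᶠ f i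
monotone⇒inflationary {f = f} mono i
  with j , j≤i , i≤fj ← injective⇒existsPivot (monotone⇒injective mono) i
  with <-cmp j i
... | tri< j<i _ _ = ℕ.≤-trans i≤fj (ℕ.<⇒≤ (mono j<i))
... | tri≈ _ refl _ = i≤fj
... | tri> _ _ i<j = contradiction j≤i (ℕ.<⇒≱ i<j)

-- The map sending each value of `π` to the value of `ρ` at the same position is strictly
-- increasing, hence inflationary. Used both ways round, this shows that the relative order
-- determines a permutation.
orderPreserving⇒≤ : (π ρ : Permutation′ n) →
  (∀ i j → (π ⟨$⟩ʳ i) < (π ⟨$⟩ʳ j) → (ρ ⟨$⟩ʳ i) < (ρ ⟨$⟩ʳ j)) →
  ∀ i → (π ⟨$⟩ʳ i) ≤ᶠ (ρ ⟨$⟩ʳ i)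
orderPreserving⇒≤ π ρ mono i =
  subst (λ l → (π ⟨$⟩ʳ i) ≤ᶠ (ρ ⟨$⟩ʳ l)) (inverseˡ π)
    (monotone⇒inflationary {f = λ v → ρ ⟨$⟩ʳ (π ⟨$⟩ˡ v)}
      (λ v<w → mono _ _ (subst₂ _<_ (sym (inverseʳ π)) (sym (inverseʳ π)) v<w))
      (π ⟨$⟩ʳ i))

permutation-injective : (π : Permutation′ n) → Injective _≡_ _≡_ (π ⟨$⟩ʳ_)
permutation-injective π eq = trans (sym (inverseˡ π)) (trans (cong (π ⟨$⟩ˡ_) eq) (inverseˡ π))

injective⇒surjective : {f : Fin n → Fin n} → Injective _≡_ _≡_ f → ∀ y → ∃[ x ] f x ≡ y
injective⇒surjective {n = suc _} {f} inj y with any? (λ x → f x ≟ y)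
... | yes hit = hit
... | no miss = contradiction
  (injective⇒≤ {f = λ x → punchOut (λ eq → miss (x , sym eq))}
    (λ eq → inj (punchOut-injective (λ e → miss (_ , sym e)) (λ e → miss (_ , sym e)) eq)))
  ℕ.1+n≰n

injective⇒permutation : (f : Fin n → Fin n) → Injective _≡_ _≡_ f → Permutation′ n
injective⇒permutation f inj =
  permutation f (proj₁ ∘ surj) (proj₂ ∘ surj) (λ x → inj (proj₂ (surj (f x))))
  where surj = injective⇒surjective inj

-- Sorting positions by distinct keys.

module Standardization (κ : Fin n → ℕ) (κ-injective : Injective _≡_ _≡_ κ) where

  -- Ranks are sizes of these sets, so bounds come from strict inclusion: `i` is missing from
  -- `below i` but lies in `below j` once `κ i < κ j`.
  below : Fin n → Subset n
  below i = tabulate λ j → does (κ j ℕ.<? κ i)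

  ∈below⁺ : ∀ {i j} → κ j <ⁿ κ i → j ∈ below i
  ∈below⁺ {i} {j} lt = lookup⇒[]= j _ (trans (lookup∘tabulate _ j) (dec-true (κ j ℕ.<? κ i) lt))

  ∈below⁻ : ∀ {i j} → j ∈ below i → κ j <ⁿ κ i
  ∈below⁻ {i} {j} j∈ = toWitness (subst T (sym eq) _)
    where
    eq : isYes (κ j ℕ.<? κ i) ≡ true
    eq = trans (isYes≗does _) (trans (sym (lookup∘tabulate _ j)) ([]=⇒lookup j∈))

  ∣below∣<n : ∀ i → ∣ below i ∣ <ⁿ n
  ∣below∣<n i = subst (∣ below i ∣ <ⁿ_) (∣⊤∣≡n n)
    (p⊂q⇒∣p∣<∣q∣ ((λ _ → ∈⊤) , i , ∈⊤ , ℕ.<-irrefl refl ∘ ∈below⁻))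

  rank : Fin n → Fin n
  rank i = fromℕ< (∣below∣<n i)

  rank⁺ : ∀ {i j} → κ i <ⁿ κ j → rank i < rank j
  rank⁺ {i} {j} lt = subst₂ _<ⁿ_ (sym (toℕ-fromℕ< _)) (sym (toℕ-fromℕ< _))
    (p⊂q⇒∣p∣<∣q∣ ((λ l∈ → ∈below⁺ (ℕ.<-trans (∈below⁻ l∈) lt))
      , i , ∈below⁺ lt , ℕ.<-irrefl refl ∘ ∈below⁻))

  rank-injective : Injective _≡_ _≡_ rank
  rank-injective {i} {j} eq with ℕ.<-cmp (κ i) (κ j)
  ... | tri< lt _ _ = contradiction (rank⁺ lt) (ℕ.<-irrefl (cong toℕ eq))
  ... | tri≈ _ e _ = κ-injective e
  ... | tri> _ _ gt = contradiction (rank⁺ gt) (ℕ.<-irrefl (cong toℕ (sym eq)))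

  rank⁻ : ∀ {i j} → rank i < rank j → κ i <ⁿ κ j
  rank⁻ {i} {j} lt with ℕ.<-cmp (κ i) (κ j)
  ... | tri< lt′ _ _ = lt′
  ... | tri≈ _ e _ = contradiction lt (ℕ.<-irrefl (cong (toℕ ∘ rank) (κ-injective e)))
  ... | tri> _ _ gt = contradiction lt (ℕ.<-asym (rank⁺ gt))

  -- Abstract, so that case analysis on its order never unfolds the counts in rank.
  abstract
    standardization : Permutation′ n
    standardization = injective⇒permutation rank rank-injective

    standardization⁺ : ∀ {i j} → κ i <ⁿ κ j → (standardization ⟨$⟩ʳ i) < (standardization ⟨$⟩ʳ j)
    standardization⁺ = rank⁺

    standardization⁻ : ∀ {i j} → (standardization ⟨$⟩ʳ i) < (standardization ⟨$⟩ʳ j) → κ i <ⁿ κ j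
    standardization⁻ = rank⁻

-- Occurrences of the two patterns.

-- As the entries of `σ` are distinct, trichotomy turns one implication into the required
-- equivalence. The premise `T (_ <ᵇ _)` computes on a concrete pattern, so false cases close by
-- absurd patterns.
contains : (π : Permutation′ n) (σ : Vec ℕ k) (is : Vec (Fin n) k) → Linked _<_ is →
  {True (all? λ a → all? λ b → (lookup σ a ℕ.≟ lookup σ b) →-dec (a ≟ b))} →
  (∀ a b → T (lookup σ a <ᵇ lookup σ b) → (π ⟨$⟩ʳ lookup is a) < (π ⟨$⟩ʳ lookup is b)) →
  Contains π σ
contains π σ is linked {distinct} ordered =
  lookup is , lookup⁺ ℕ.<-trans linked , λ a b → mk⇔ (fwd a b) (bwd a b)
  where
  fwd : ∀ a b → lookup σ a <ⁿ lookup σ b → (π ⟨$⟩ʳ lookup is a) < (π ⟨$⟩ʳ lookup is b)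
  fwd a b = ordered a b ∘ ℕ.<⇒<ᵇ
  bwd : ∀ a b → (π ⟨$⟩ʳ lookup is a) < (π ⟨$⟩ʳ lookup is b) → lookup σ a <ⁿ lookup σ b
  bwd a b lt with ℕ.<-cmp (lookup σ a) (lookup σ b)
  ... | tri< lt′ _ _ = lt′
  ... | tri≈ _ e _ = contradiction lt (ℕ.<-irrefl
    (cong (λ c → toℕ (π ⟨$⟩ʳ lookup is c)) (toWitness distinct a b e)))
  ... | tri> _ _ gt = contradiction lt (ℕ.<-asym (fwd b a gt))

contains321 : (π : Permutation′ n) → ∀ {i j k} → i < j → j < k →
  (π ⟨$⟩ʳ j) < (π ⟨$⟩ʳ i) → (π ⟨$⟩ʳ k) < (π ⟨$⟩ʳ j) → Contains π (proj₂ p321)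
contains321 π {i} {j} {k} i<j j<k ji kj =
  contains π (proj₂ p321) (i ∷ j ∷ k ∷ []) (i<j ∷ j<k ∷ [-]) λ where
    0F 0F () ; 0F 1F () ; 0F 2F ()
    1F 0F _ → ji ; 1F 1F () ; 1F 2F ()
    2F 0F _ → ℕ.<-trans kj ji ; 2F 1F _ → kj ; 2F 2F ()

contains2143 : (π : Permutation′ n) → ∀ {i j k l} → i < j → j < k → k < l →
  (π ⟨$⟩ʳ j) < (π ⟨$⟩ʳ i) → (π ⟨$⟩ʳ i) < (π ⟨$⟩ʳ l) → (π ⟨$⟩ʳ l) < (π ⟨$⟩ʳ k) →
  Contains π (proj₂ p2143)
contains2143 π {i} {j} {k} {l} i<j j<k k<l ji il lk =
  contains π (proj₂ p2143) (i ∷ j ∷ k ∷ l ∷ []) (i<j ∷ j<k ∷ k<l ∷ [-]) λ where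
    0F 0F () ; 0F 1F () ; 0F 2F _ → ℕ.<-trans il lk ; 0F 3F _ → il
    1F 0F _ → ji ; 1F 1F () ; 1F 2F _ → ℕ.<-trans ji (ℕ.<-trans il lk) ; 1F 3F _ → ℕ.<-trans ji il
    2F 0F () ; 2F 1F () ; 2F 2F () ; 2F 3F ()
    3F 0F () ; 3F 1F () ; 3F 2F _ → lk ; 3F 3F ()

-- Dominated and high positions.

Dominated : Permutation′ n → Pred (Fin n) 0ℓ
Dominated π i = ∃[ k ] k < i × (π ⟨$⟩ʳ i) < (π ⟨$⟩ʳ k)

dominated? : (π : Permutation′ n) → Decidable (Dominated π)
dominated? π i = any? λ k → (k <? i) ×-dec ((π ⟨$⟩ʳ i) <? (π ⟨$⟩ʳ k))

-- For D the dominated positions, the positions i with i + 1 before every element of D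
-- are left-to-right maxima but count as low: they are the initial fixed points.
High : Pred (Fin n) 0ℓ → Pred (Fin n) 0ℓ
High D i = ¬ D i × ∃[ k ] toℕ k ≤ suc (toℕ i) × D k

high? : {D : Pred (Fin n) 0ℓ} → Decidable D → Decidable (High D)
high? D? i = ¬? (D? i) ×-dec any? λ k → (toℕ k ℕ.≤? suc (toℕ i)) ×-dec D? k

-- Inversions of a permutation in the class.

module _ (π : Permutation′ n)
  (fishburn : Fishburn π) (avoids321 : Avoids π (proj₂ p321)) (avoids2143 : Avoids π (proj₂ p2143))
  where

  inversion⇒high : ∀ {i j} → i < j → (π ⟨$⟩ʳ j) < (π ⟨$⟩ʳ i) → High (Dominated π) i × Dominated π j
  inversion⇒high {i} {j} i<j inv = (undominated , decidable-stable dominatedSoon? absurd) , i , i<j , inv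
    where
    undominated : ¬ Dominated π i
    undominated (k , k<i , lt) = avoids321 (contains321 π k<i i<j lt inv)

    dominatedSoon? : Dec (∃[ k ] toℕ k ≤ suc (toℕ i) × Dominated π k)
    dominatedSoon? = any? λ k → (toℕ k ℕ.≤? suc (toℕ i)) ×-dec dominated? π k

    absurd : ¬ ¬ (∃[ k ] toℕ k ≤ suc (toℕ i) × Dominated π k)
    -- Were all positions up to i + 1 undominated, π would increase there, and walking
    -- through the values from π j up to π i would give a Fishburn pattern (l, l⁺, w).
    absurd none
      with v , v⁺ , _ , v⁺≡1+v , i<v⁻¹ , i≮v⁺⁻¹ ← crossing (λ v → i <? (π ⟨$⟩ˡ v)) (ℕ.<⇒≤ inv)
        (subst (i <_) (sym (inverseˡ π)) i<j) (ℕ.<-irrefl (cong toℕ (sym (inverseˡ π))))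
      = fishburn (l , l⁺ , w , l⁺≡1+l , l⁺<w , πl≡1+πw , πl<πl⁺)
      where
      l = π ⟨$⟩ˡ v⁺
      w = π ⟨$⟩ˡ v
      l≤i : l ≤ᶠ i
      l≤i = ℕ.≮⇒≥ i≮v⁺⁻¹
      1+l≤w : suc (toℕ l) ≤ toℕ w
      1+l≤w = ℕ.≤-<-trans l≤i i<v⁻¹
      l⁺ = fromℕ< (ℕ.≤-<-trans 1+l≤w (toℕ<n w))
      l⁺≡1+l : toℕ l⁺ ≡ suc (toℕ l)
      l⁺≡1+l = toℕ-fromℕ< _
      πl≡1+πw : toℕ (π ⟨$⟩ʳ l) ≡ suc (toℕ (π ⟨$⟩ʳ w))
      πl≡1+πw = trans (cong toℕ (inverseʳ π)) (trans v⁺≡1+v (cong (suc ∘ toℕ) (sym (inverseʳ π))))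
      πl<πl⁺ : (π ⟨$⟩ʳ l) < (π ⟨$⟩ʳ l⁺)
      πl<πl⁺ with <-cmp (π ⟨$⟩ʳ l) (π ⟨$⟩ʳ l⁺)
      ... | tri< lt _ _ = lt
      ... | tri≈ _ e _ = contradiction (trans (sym l⁺≡1+l) (cong toℕ (sym (permutation-injective π e)))) ℕ.1+n≢n
      -- A descent here would make `l⁺`, which is at most `i + 1`, dominated by `l`.
      ... | tri> _ _ gt = ⊥-elim
        (none (l⁺ , subst (_≤ suc (toℕ i)) (sym l⁺≡1+l) (s≤s l≤i) , l , ℕ.≤-reflexive (sym l⁺≡1+l) , gt))
      -- `1+l≤w` leaves only `l⁺ = w` to exclude, where one value would lie both below and above
      -- `π l`.
      l⁺<w : l⁺ < w
      l⁺<w with <-cmp l⁺ w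
      ... | tri< lt _ _ = lt
      ... | tri≈ _ e _ = contradiction
        (subst (toℕ (π ⟨$⟩ʳ w) <ⁿ_) (sym πl≡1+πw) ℕ.≤-refl)
        (ℕ.<-asym (subst (λ x → (π ⟨$⟩ʳ l) < (π ⟨$⟩ʳ x)) e πl<πl⁺))
      ... | tri> _ _ gt = contradiction (subst (_≤ toℕ w) (sym l⁺≡1+l) 1+l≤w) (ℕ.<⇒≱ gt)

  -- Otherwise `π i < π j`, and with `m` dominating `k` and `l` dominating `j`, the positions
  -- `m < k < l < j` carry 2143.
  high⇒inversion : ∀ {i j} → i < j → High (Dominated π) i → Dominated π j → (π ⟨$⟩ʳ j) < (π ⟨$⟩ʳ i)
  high⇒inversion {i} {j} i<j (undominated , k , k≤1+i , m , m<k , πk<πm) (l , l<j , πj<πl)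
    with <-cmp (π ⟨$⟩ʳ i) (π ⟨$⟩ʳ j)
  ... | tri> _ _ gt = gt
  ... | tri≈ _ e _ = contradiction i<j (ℕ.<-irrefl (cong toℕ (permutation-injective π e)))
  ... | tri< πi<πj _ _ = contradiction (contains2143 π m<k k<l l<j πk<πm πm<πj πj<πl) avoids2143
    where
    -- From `m < k ≤ i + 1` comes `m ≤ i`, and `i` being undominated gives `π m ≤ π i`.
    πm<πj : (π ⟨$⟩ʳ m) < (π ⟨$⟩ʳ j)
    πm<πj with <-cmp m i
    ... | tri< m<i _ _ = ℕ.≤-<-trans (ℕ.≮⇒≥ λ lt → undominated (m , m<i , lt)) πi<πj
    ... | tri≈ _ refl _ = πi<πj
    ... | tri> _ _ i<m = contradiction (ℕ.≤-trans m<k k≤1+i) (ℕ.<⇒≱ (s≤s i<m))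
    i<l : i < l
    i<l with <-cmp i l
    ... | tri< i<l _ _ = i<l
    ... | tri≈ _ refl _ = contradiction πj<πl (ℕ.<-asym πi<πj)
    ... | tri> _ _ l<i = contradiction (l , l<i , ℕ.<-trans πi<πj πj<πl) undominated
    -- `k ≤ i + 1 ≤ l`, and `k = l` fails because `π k < π m < π j < π l`.
    k<l : k < l
    k<l = ℕ.≤∧≢⇒< (ℕ.≤-trans k≤1+i i<l)
      λ k≡l → ℕ.<-asym (ℕ.<-trans πm<πj πj<πl)
        (subst (λ x → (π ⟨$⟩ʳ x) < (π ⟨$⟩ʳ m)) (toℕ-injective k≡l) πk<πm)

-- A permutation with prescribed dominated set.

module Shuffle (D : Pred (Fin (suc m)) 0ℓ) (D? : Decidable D) (¬D0 : ¬ D zero) where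

  -- The shift `suc m` exceeds every position, so high keys exceed all low ones. Taking the decision
  -- as argument lets a case split on `high?` compute the key.
  offset : ∀ {i} → Dec (High D i) → ℕ
  offset (yes _) = suc m
  offset (no _)  = 0

  -- Sorts the low positions before the high ones, keeping each group in order.
  κ : Fin (suc m) → ℕ
  κ i = offset (high? D? i) + toℕ i

  κ-high : ∀ {i j} → High D i → ¬ High D j → κ j <ⁿ κ i
  κ-high {i} {j} hi ¬hj with high? D? i | high? D? j
  ... | yes _  | no _   = ℕ.m≤n⇒m≤n+o (toℕ i) (toℕ<n j)
  ... | yes _  | yes hj = contradiction hj ¬hj
  ... | no ¬hi | _      = contradiction hi ¬hi

  κ-inversion : ∀ {i j} → i < j → κ j <ⁿ κ i → High D i × ¬ High D j
  κ-inversion {i} {j} i<j inv with high? D? i | high? D? j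
  ... | yes hi | no ¬hj = hi , ¬hj
  ... | yes _  | yes _  = contradiction (ℕ.+-cancelˡ-< (suc m) (toℕ j) (toℕ i) inv) (ℕ.<-asym i<j)
  ... | no _   | yes _  = contradiction (ℕ.<-≤-trans i<j (ℕ.m≤n+m (toℕ j) (suc m))) (ℕ.<-asym inv)
  ... | no _   | no _   = contradiction inv (ℕ.<-asym i<j)

  κ-injective : Injective _≡_ _≡_ κ
  κ-injective {i} {j} eq with high? D? i | high? D? j
  ... | yes _ | no _  = contradiction (ℕ.≤-trans (ℕ.m≤m+n (suc m) (toℕ i)) (ℕ.≤-reflexive eq)) (ℕ.<⇒≱ (toℕ<n j))
  ... | yes _ | yes _ = toℕ-injective (ℕ.+-cancelˡ-≡ (suc m) (toℕ i) (toℕ j) eq)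
  ... | no _  | yes _ = contradiction (ℕ.≤-trans (ℕ.m≤m+n (suc m) (toℕ j)) (ℕ.≤-reflexive (sym eq))) (ℕ.<⇒≱ (toℕ<n i))
  ... | no _  | no _  = toℕ-injective eq

  open Standardization κ κ-injective public using () renaming
    (standardization to shuffle; standardization⁺ to shuffle⁺; standardization⁻ to shuffle⁻)

  inversion⇒ : ∀ {i j} → i < j → (shuffle ⟨$⟩ʳ j) < (shuffle ⟨$⟩ʳ i) → High D i × ¬ High D j
  inversion⇒ i<j = κ-inversion i<j ∘ shuffle⁻

  -- Between `zero` outside `D` and `k` inside it, some `v` outside `D` is followed by a `v⁺`
  -- inside; this successor makes `v` high.
  highBefore : ∀ {k} → D k → ∃[ i ] i < k × High D i
  highBefore {k} Dk
    with v , v⁺ , v⁺≤k , v⁺≡1+v , ¬Dv , ¬¬Dv⁺ ← crossing {P = ¬_ ∘ D} (¬? ∘ D?) {zero} {k} z≤n ¬D0 (λ ¬Dk → ¬Dk Dk)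
    = v , subst (_≤ toℕ k) v⁺≡1+v v⁺≤k
    , ¬Dv , v⁺ , ℕ.≤-reflexive v⁺≡1+v , decidable-stable (D? v⁺) ¬¬Dv⁺

  -- The element of `D` that makes a position high makes every later position outside `D` high too,
  -- so only elements of `D` can be dominated. Conversely, an element of `D` is low and has a high
  -- position before it.
  shuffle-dominated : ∀ i → Dominated shuffle i ⇔ D i
  shuffle-dominated i = mk⇔ to from
    where
    to : Dominated shuffle i → D i
    to (l , l<i , lt) with (_ , k , k≤1+l , Dk) , ¬hi ← inversion⇒ l<i lt =
      decidable-stable (D? i) λ ¬Di → ¬hi (¬Di , k , ℕ.≤-trans k≤1+l (ℕ.m≤n⇒m≤1+n l<i) , Dk)
    from : D i → Dominated shuffle i
    from Di with l , l<i , hl ← highBefore Di = l , l<i , shuffle⁺ (κ-high hl (λ (¬Di , _) → ¬Di Di))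

  -- The middle entry would be low as the bottom of one inversion and high as the top of the other.
  shuffle-avoids321 : Avoids shuffle (proj₂ p321)
  shuffle-avoids321 (p , mono , order) = proj₂ (inv {0F} {1F} z<s (s<s (s<s z<s))) (proj₁ (inv {1F} {2F} (s<s z<s) (s<s z<s)))
    where
    inv : ∀ {a b} → a < b → lookup (proj₂ p321) b <ⁿ lookup (proj₂ p321) a → High D (p a) × ¬ High D (p b)
    inv {a} {b} a<b lt = inversion⇒ (mono a<b) (Equivalence.to (order b a) lt)

  -- The 2 would be high and the 3 low, yet low values lie below high ones.
  shuffle-avoids2143 : Avoids shuffle (proj₂ p2143)
  shuffle-avoids2143 (p , mono , order) = ℕ.<-asym
    (Equivalence.to (order 0F 3F) (s<s (s<s z<s)))
    (shuffle⁺ (κ-high (proj₁ (inv {0F} {1F} z<s (s<s z<s)))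
                   (proj₂ (inv {2F} {3F} (s<s (s<s z<s)) (s<s (s<s (s<s z<s)))))))
    where
    inv : ∀ {a b} → a < b → lookup (proj₂ p2143) b <ⁿ lookup (proj₂ p2143) a → High D (p a) × ¬ High D (p b)
    inv {a} {b} a<b lt = inversion⇒ (mono a<b) (Equivalence.to (order b a) lt)

  -- Here `j` is high and `k` low. If the witness `l` is `j⁺`, then `j⁺` is low and `j` is no
  -- ascent. Otherwise `l ≤ j` has a high `i` before it, whose value would lie strictly between the
  -- consecutive values at `k` and `j`.
  shuffle-fishburn : Fishburn shuffle
  shuffle-fishburn (j , j⁺ , k , j⁺≡1+j , j⁺<k , πj≡1+πk , πj<πj⁺)
    with hj@(_ , l , l≤1+j , Dl) , ¬hk ←
           inversion⇒ (ℕ.<-trans (ℕ.≤-reflexive (sym j⁺≡1+j)) j⁺<k) (ℕ.≤-reflexive (sym πj≡1+πk))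
    with ℕ.m≤n⇒m<n∨m≡n l≤1+j
  ... | inj₂ l≡1+j =
    ℕ.<-asym πj<πj⁺ (shuffle⁺ (κ-high hj (λ (¬Dj⁺ , _) → ¬Dj⁺ (subst D (toℕ-injective (trans l≡1+j (sym j⁺≡1+j))) Dl))))
  ... | inj₁ l<1+j
    with i , i<l , hi ← highBefore Dl
    with <-cmp (shuffle ⟨$⟩ʳ i) (shuffle ⟨$⟩ʳ j)
  ... | tri< πi<πj _ _ = ℕ.<⇒≱ (shuffle⁺ (κ-high hi ¬hk)) (s≤s⁻¹ (subst (toℕ (shuffle ⟨$⟩ʳ i) <ⁿ_) πj≡1+πk πi<πj))
  ... | tri≈ _ e _     = ℕ.<-irrefl (cong toℕ (permutation-injective shuffle e)) (ℕ.<-≤-trans i<l (s≤s⁻¹ l<1+j))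
  ... | tri> _ _ πj<πi = proj₂ (inversion⇒ (ℕ.<-≤-trans i<l (s≤s⁻¹ l<1+j)) πj<πi) hj

-- Dominated sets as numbers below `2 ^ m`, and the bijection.

encode : (Fin m → Bool) → Fin (2 ^ m)
encode s = funToFin (Inverse.from 2↔Bool ∘ s)

decode : ∀ m → Fin (2 ^ m) → Fin m → Bool
decode m y = Inverse.to 2↔Bool ∘ finToFun y

funToFin-cong : {f g : Fin m → Fin n} → f ≗ g → funToFin f ≡ funToFin g
funToFin-cong {m = zero}  f≗g = refl
funToFin-cong {m = suc _} f≗g = cong₂ combine (f≗g zero) (funToFin-cong (f≗g ∘ suc))

encode-cong : {s t : Fin m → Bool} → s ≗ t → encode s ≡ encode t
encode-cong s≗t = funToFin-cong (cong (Inverse.from 2↔Bool) ∘ s≗t)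

decode-encode : (s : Fin m → Bool) → decode m (encode s) ≗ s
decode-encode s i = Inverse.inverseˡ 2↔Bool (finToFun-funToFin _ i)

encode-decode : ∀ m (y : Fin (2 ^ m)) → encode (decode m y) ≡ y
encode-decode m y = trans (funToFin-cong {m = m} (λ _ → Inverse.inverseʳ 2↔Bool refl)) (funToFin-finToFin {m} {2} y)

-- The first position is never dominated, so `m` bits suffice for length `suc m`.
bits : Permutation′ (suc m) → Fin m → Bool
bits π i = does (dominated? π (suc i))

bits-cong : {π ρ : Permutation′ (suc m)} → π ≈ ρ → bits π ≗ bits ρ
bits-cong {π = π} {ρ} π≈ρ i = does-⇔ (mk⇔ (transfer {π} {ρ} π≈ρ) (transfer {ρ} {π} (sym ∘ π≈ρ)))
  (dominated? π (suc i)) (dominated? ρ (suc i))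
  where
  transfer : ∀ {π ρ} → π ≈ ρ → ∀ {i} → Dominated π i → Dominated ρ i
  transfer π≈ρ (k , k<i , lt) = k , k<i , subst₂ _<_ (π≈ρ _) (π≈ρ _) lt

does-≡⇒ : {A B : Set} (a? : Dec A) (b? : Dec B) → does a? ≡ does b? → A → B
does-≡⇒ _       (yes b) _  _ = b
does-≡⇒ (no ¬a) (no _)  _  a = contradiction a ¬a

bits⇒dominated : (π ρ : Permutation′ (suc m)) → bits π ≗ bits ρ → ∀ {i} → Dominated π i → Dominated ρ i
-- There is no case `zero`, since no position precedes it.
bits⇒dominated π ρ same {suc i} = does-≡⇒ (dominated? π (suc i)) (dominated? ρ (suc i)) (same i)

corollary9p8 : (n : ℕ) → 1 ≤ n → HasCardinality (F n (p321 ∷ p2143 ∷ [])) (2 ^ (n ∸ 1))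
corollary9p8 (suc m) _ = record
  { to        = λ (π , _) → encode (bits π)
  ; cong      = λ { {π , _} {ρ , _} π≈ρ → encode-cong (bits-cong {π = π} {ρ} π≈ρ) }
  ; bijective = (λ {x} {y} → injective x y) , surjective
  }
  where
  FishburnAvoiders = F (suc m) (p321 ∷ p2143 ∷ [])
  open Setoid FishburnAvoiders using (Carrier)

  -- The criterion for an inversion mentions only the dominated set, so equal bits carry it from `π`
  -- to `ρ`; its negative part uses the transfer from `ρ` back to `π`.
  inversions : ((π , _) (ρ , _) : Carrier) → bits π ≗ bits ρ →
    ∀ {i j} → i < j → (π ⟨$⟩ʳ j) < (π ⟨$⟩ʳ i) → (ρ ⟨$⟩ʳ j) < (ρ ⟨$⟩ʳ i)
  inversions (π , fishπ , π∌321 ∷ π∌2143 ∷ []) (ρ , fishρ , ρ∌321 ∷ ρ∌2143 ∷ []) same i<j inv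
    with (¬Di , k , k≤1+i , Dk) , Dj ← inversion⇒high π fishπ π∌321 π∌2143 i<j inv =
    high⇒inversion ρ fishρ ρ∌321 ρ∌2143 i<j
      (¬Di ∘ bits⇒dominated ρ π (sym ∘ same) , k , k≤1+i , bits⇒dominated π ρ same Dk)
      (bits⇒dominated π ρ same Dj)

  ordered : (x@(π , _) y@(ρ , _) : Carrier) → bits π ≗ bits ρ →
    ∀ i j → (π ⟨$⟩ʳ i) < (π ⟨$⟩ʳ j) → (ρ ⟨$⟩ʳ i) < (ρ ⟨$⟩ʳ j)
  ordered x@(π , _) y@(ρ , _) same i j πi<πj with <-cmp i j
  ... | tri≈ _ refl _ = contradiction πi<πj (ℕ.<-irrefl refl)
  ... | tri> _ _ j<i  = inversions x y same j<i πi<πj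
  ... | tri< i<j _ _ with <-cmp (ρ ⟨$⟩ʳ i) (ρ ⟨$⟩ʳ j)
  ...   | tri< lt _ _ = lt
  ...   | tri≈ _ e _  = contradiction (cong toℕ (permutation-injective ρ e)) (ℕ.<⇒≢ i<j)
  ...   | tri> _ _ gt = contradiction πi<πj (ℕ.<-asym (inversions y x (sym ∘ same) i<j gt))

  injective : ((π , _) (ρ , _) : Carrier) → encode (bits π) ≡ encode (bits ρ) → π ≈ ρ
  injective x@(π , _) y@(ρ , _) eq i = ≤-antisym
    (orderPreserving⇒≤ π ρ (ordered x y same) i)
    (orderPreserving⇒≤ ρ π (ordered y x (sym ∘ same)) i)
    where
    same : bits π ≗ bits ρ
    same i = trans (sym (decode-encode _ i)) (trans (cong (λ c → decode m c i) eq) (decode-encode _ i))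

  surjective : Surjective (Setoid._≈_ FishburnAvoiders) _≡_ (λ (π , _) → encode (bits π))
  surjective y =
    (shuffle , shuffle-fishburn , shuffle-avoids321 ∷ shuffle-avoids2143 ∷ []) ,
    -- Surjectivity over the setoid concerns every `π` pointwise equal to `shuffle`, so its bits are
    -- first compared with those of `shuffle`.
    λ { {π , _} π≈shuffle → trans (encode-cong (λ i → trans (bits-cong {π = π} {shuffle} π≈shuffle i)
      (does-⇔ (shuffle-dominated (suc i)) (dominated? shuffle (suc i)) (T? (decode m y i))))) (encode-decode m y) }
    where
    D : Pred (Fin (suc m)) 0ℓ
    D zero    = ⊥
    D (suc i) = T (decode m y i)
    D? : Decidable D
    D? zero    = no id
    D? (suc i) = T? (decode m y i)
    open Shuffle D D? id
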